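{- For every integer $n\ge 7$, the wheel $W_{1,n}$ satisfies $$\dim_{n\ell}(W_{1,n})=\left\lfloor \frac{2n}{5}\right\rfloor.$$
   Context: The wheel $W_{1,n}=K_1+C_n$ is obtained from the cycle $C_n$ by adding one vertex (the center) adjacent to all cycle vertices. $d(u,v)$ is the shortest-path distance. A set $X$ of vertices resolves two vertices $u,v$ if some $x\in X$ satisfies $d(u,x)\neq d(v,x)$. $X$ is a nonlocal resolving set if it resolves every pair of distinct non-adjacent vertices; the nonlocal metric dimension $\dim_{n\ell}$ is the minimum size of a nonlocal resolving set. -}

module Defs where

open import Data.Fin using (Fin; toℕ; splitAt)
open import Data.Fin.Subset using (Subset; _∈_; ∣_∣)
open import Data.Nat using (ℕ; suc; _+_; _≤_; s≤s)
open import Data.Nat.Properties using (1+n≢n; ≤-antisym)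
open import Data.Product using (∃-syntax; Σ-syntax; _×_; _,_)
open import Data.Sum using (_⊎_; inj₁; inj₂)
open import Data.Unit using (⊤; tt)
open import Level using (0ℓ)
open import Relation.Binary.Core using (Rel)
open import Relation.Binary.Definitions using (Symmetric; Irreflexive)
open import Relation.Binary.PropositionalEquality using (_≡_; _≢_; refl; sym)
open import Relation.Nullary using (¬_)

record Graph (n : ℕ) : Set₁ where
  field
    Adj         : Rel (Fin n) 0ℓ
    symmetric   : Symmetric Adj
    irreflexive : Irreflexive _≡_ Adj

open Graph public

IsLeast : (ℕ → Set) → ℕ → Set
IsLeast P k = P k × (∀ j → P j → k ≤ j)

IsLeast-unique : ∀ {P j k} → IsLeast P j → IsLeast P k → j ≡ k
IsLeast-unique (pj , j≤) (pk , k≤) = ≤-antisym (j≤ _ pk) (k≤ _ pj)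

data Walk {n} (G : Graph n) : Fin n → Fin n → ℕ → Set where
  []  : ∀ {u} → Walk G u u 0
  _∷_ : ∀ {u v w k} → Adj G u v → Walk G v w k → Walk G u w (suc k)

-- The graph of the distance function, d(u,v) = k.  A walk of minimal
-- length is a path, so minimising over walks or over paths is the same.
Distance : ∀ {n} → Graph n → Fin n → Fin n → ℕ → Set
Distance G u v = IsLeast (Walk G u v)

-- Both distances are required to exist, so this is the usual notion for
-- connected graphs only (there is no distance ∞).
Resolves : ∀ {n} → Graph n → Subset n → Fin n → Fin n → Set
Resolves G X u v =
  ∃[ x ] x ∈ X × (∃[ j ] ∃[ k ] Distance G u x j × Distance G v x k × j ≢ k)

NonlocalResolving : ∀ {n} → Graph n → Subset n → Set
NonlocalResolving G X = ∀ u v → u ≢ v → ¬ Adj G u v → Resolves G X u v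

-- dim_nℓ(G) = k
NonlocalMetricDimension : ∀ {n} → Graph n → ℕ → Set
NonlocalMetricDimension {n} G =
  IsLeast (λ k → Σ[ X ∈ Subset n ] NonlocalResolving G X × ∣ X ∣ ≡ k)

complete : ∀ n → Graph n
complete n = record
  { Adj         = _≢_
  ; symmetric   = λ u≢v v≡u → u≢v (sym v≡u)
  ; irreflexive = λ u≡v u≢v → u≢v u≡v
  }

-- j is the successor of i in the cyclic order 0, 1, …, n - 1, 0.
CyclicSuc : ∀ {n} → Fin n → Fin n → Set
CyclicSuc {n} i j = suc (toℕ i) ≡ toℕ j ⊎ (suc (toℕ i) ≡ n × toℕ j ≡ 0)

-- For n = 1 the relation below would be a loop, for n = 2 it would be a path.
cycle : ∀ n → 3 ≤ n → Graph n
cycle n 3≤n = record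
  { Adj         = λ i j → CyclicSuc i j ⊎ CyclicSuc j i
  ; symmetric   = λ { (inj₁ p) → inj₂ p ; (inj₂ p) → inj₁ p }
  ; irreflexive = λ { {i} refl (inj₁ p) → noLoop 3≤n i p
                    ; {i} refl (inj₂ p) → noLoop 3≤n i p }
  }
  where
  noLoop : ∀ {n} → 3 ≤ n → (i : Fin n) → ¬ CyclicSuc i i
  noLoop _ i (inj₁ 1+i≡i) = 1+n≢n 1+i≡i
  noLoop (s≤s (s≤s _)) Fin.zero (inj₂ (() , _))
  noLoop _ (Fin.suc i) (inj₂ (_ , ()))

JoinAdj : ∀ {m n} → Graph m → Graph n → Rel (Fin m ⊎ Fin n) 0ℓ
JoinAdj G H (inj₁ u) (inj₁ v) = Adj G u v
JoinAdj G H (inj₁ _) (inj₂ _) = ⊤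
JoinAdj G H (inj₂ _) (inj₁ _) = ⊤
JoinAdj G H (inj₂ u) (inj₂ v) = Adj H u v

-- The join G + H; the first m vertices are those of G.
join : ∀ {m n} → Graph m → Graph n → Graph (m + n)
join {m} {n} G H = record
  { Adj         = λ u v → JoinAdj G H (splitAt m u) (splitAt m v)
  ; symmetric   = λ {u} {v} → joinSym (splitAt m u) (splitAt m v)
  ; irreflexive = λ { {u} refl → joinIrrefl (splitAt m u) }
  }
  where
  joinSym : ∀ s t → JoinAdj G H s t → JoinAdj G H t s
  joinSym (inj₁ _) (inj₁ _) p = symmetric G p
  joinSym (inj₁ _) (inj₂ _) _ = tt
  joinSym (inj₂ _) (inj₁ _) _ = tt
  joinSym (inj₂ _) (inj₂ _) p = symmetric H p

  joinIrrefl : ∀ s → ¬ JoinAdj G H s s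
  joinIrrefl (inj₁ _) = irreflexive G refl
  joinIrrefl (inj₂ _) = irreflexive H refl

wheel : ∀ n → 3 ≤ n → Graph (1 + n)
wheel n 3≤n = join (complete 1) (cycle n 3≤n)

{-# OPTIONS --safe #-}

-- The hub resolves no pair of rim vertices and is adjacent to all of them, so only the trace of X on
-- the rim matters.  Two non-adjacent rim vertices outside X are unresolved exactly when they have the
-- same rim neighbours in X: either both have none, or both have the same single one, lying between
-- them.  Let k = |X|, and among the vertices outside X let e have no neighbour in X and s exactly one.
-- Then e ≤ 2, as vertices of the first kind are pairwise adjacent, and s ≤ k, as each element of X is
-- the only neighbour of at most one vertex.  Counting neighbours in X gives 2n ≤ 4k + 2e + s ≤ 5k + 4.
-- Optimal sets repeat the block ●○●○○, with one exceptional gap of length 3 or 4 when needed.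
module Submission where

open import Defs
open import Data.Bool using (Bool; true; false; not; _∧_)
open import Data.Bool.Properties using (¬-not) renaming (_≟_ to _≟ᵇ_)
open import Data.Empty using (⊥; ⊥-elim)
open import Data.Fin using (Fin; zero; suc; toℕ; fromℕ<)
open import Data.Fin.Properties using (toℕ-injective; toℕ-fromℕ<; toℕ<n; any?; all?)
import Data.Fin.Properties as Fin
open import Data.Fin.Subset using (Subset; _∈_; _∉_; ∣_∣)
open import Data.Fin.Subset.Properties using (_∈?_)
open import Data.List using (List; []; _∷_)
open import Data.Nat using (ℕ; zero; suc; _+_; _∸_; _*_; _/_; _%_; _≤_; _<_; z≤n; s≤s; s≤s⁻¹; NonZero; _≟_)
open import Data.Nat.DivMod
open import Data.Nat.Divisibility using (_∣_; divides; n∣m*n; >⇒∤; ∣m+n∣m⇒∣n)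
open import Data.Nat.Properties using (≤-trans; m≤m+n; +-assoc; +-comm; +-suc; +-cancelˡ-≡; +-mono-≤; +-monoˡ-≤; +-monoʳ-≤; ≤-refl; ≤-reflexive; <-trans; <⇒≤; <⇒≢; <⇒≱; m≤n⇒m<n∨m≡n; m≤n⇒∃[o]m+o≡n; n<1+n; 1+n≢n; n≤1+n; m≤n+m; m+[n∸m]≡n; suc-injective; +-identityʳ; <-cmp; <-asym; <-irrefl; ≮⇒≥; +-cancelˡ-<; _<?_; module ≤-Reasoning)
open import Data.Nat.Tactic.RingSolver using (solve-∀)
open import Data.Product using (∃-syntax; _×_; _,_; proj₁; proj₂)
open import Data.Sum using (_⊎_; inj₁; inj₂; swap)
import Data.Sum as Sum
open import Data.Unit using (tt)
open import Data.Vec using ([]; _∷_; lookup; tabulate; there)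
open import Data.Vec.Properties using (lookup∘tabulate; lookup⇒[]=; []=⇒lookup)
open import Function using (_∘_)
open import Relation.Binary.Definitions using (tri<; tri≈; tri>)
open import Relation.Binary.PropositionalEquality using (_≡_; _≢_; refl; sym; trans; cong; cong₂; subst; module ≡-Reasoning)
open import Relation.Nullary using (¬_; Dec; yes; no; contradiction)
open import Relation.Nullary.Decidable using (toWitness; _×-dec_; _⊎-dec_; _→-dec_; ¬?)

-- Finite sums

∑< : ℕ → (ℕ → ℕ) → ℕ
∑< zero    f = 0
∑< (suc n) f = f 0 + ∑< n (f ∘ suc)

∑<-suc : ∀ n f → ∑< (suc n) f ≡ ∑< n f + f n
∑<-suc zero    f = +-comm (f 0) 0
∑<-suc (suc n) f = trans (cong (f 0 +_) (∑<-suc n (f ∘ suc))) (sym (+-assoc (f 0) _ _))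

∑<-+ : ∀ n f g → ∑< n (λ i → f i + g i) ≡ ∑< n f + ∑< n g
∑<-+ zero    f g = refl
∑<-+ (suc n) f g = trans (cong (f 0 + g 0 +_) (∑<-+ n (f ∘ suc) (g ∘ suc))) (interchange (f 0) (g 0) _ _)
  where
  interchange : ∀ a b c d → a + b + (c + d) ≡ a + c + (b + d)
  interchange = solve-∀

∑<-mono : ∀ n {f g} → (∀ i → i < n → f i ≤ g i) → ∑< n f ≤ ∑< n g
∑<-mono zero    f≤g = z≤n
∑<-mono (suc n) f≤g = +-mono-≤ (f≤g 0 (s≤s z≤n)) (∑<-mono n (λ i i<n → f≤g (suc i) (s≤s i<n)))

∑<-const : ∀ n c → ∑< n (λ _ → c) ≡ n * c
∑<-const zero    c = refl
∑<-const (suc n) c = cong (c +_) (∑<-const n c)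

Periodic : ∀ {A : Set} → ℕ → (ℕ → A) → Set
Periodic n f = ∀ i → f (i + n) ≡ f i

-- The first `suc n` values can be split at either end, and the end terms `f 0` and `f n` agree.
∑<-shift : ∀ n {f} → Periodic n f → ∑< n (f ∘ suc) ≡ ∑< n f
∑<-shift n {f} per = +-cancelˡ-≡ (f 0) _ _ (begin
  f 0 + ∑< n (f ∘ suc) ≡⟨ ∑<-suc n f ⟩
  ∑< n f + f n         ≡⟨ cong (∑< n f +_) (per 0) ⟩
  ∑< n f + f 0         ≡⟨ +-comm (∑< n f) (f 0) ⟩
  f 0 + ∑< n f         ∎)
  where open ≡-Reasoning

∑<-shift² : ∀ n {f} → Periodic n f → ∑< n (f ∘ (2 +_)) ≡ ∑< n f
∑<-shift² n per = trans (∑<-shift n (per ∘ suc)) (∑<-shift n per)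

𝟙 : Bool → ℕ
𝟙 false = 0
𝟙 true  = 1

module _ (b : ℕ → Bool) where

  ∑<-𝟙≤0 : ∀ n → (∀ i → i < n → b i ≡ true → ⊥) → ∑< n (𝟙 ∘ b) ≤ 0
  ∑<-𝟙≤0 n none = ≤-trans (∑<-mono n term≤0) (≤-reflexive (trans (∑<-const n 0) (n*0≡0 n)))
    where
    n*0≡0 : ∀ n → n * 0 ≡ 0
    n*0≡0 = solve-∀
    term≤0 : ∀ i → i < n → 𝟙 (b i) ≤ 0
    term≤0 i i<n with b i in eq
    ... | false = z≤n
    ... | true  = ⊥-elim (none i i<n eq)

  -- A true value at the last index completes any forbidden tuple among the earlier ones, which
  -- therefore satisfy the hypothesis of the preceding bound.
  ∑<-𝟙≤1 : ∀ n → (∀ i j → i < j → j < n → b i ≡ true → b j ≡ true → ⊥) → ∑< n (𝟙 ∘ b) ≤ 1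
  ∑<-𝟙≤1 zero    no2 = z≤n
  ∑<-𝟙≤1 (suc n) no2 rewrite ∑<-suc n (𝟙 ∘ b) with b n in eq
  ... | false = +-monoˡ-≤ 0 (∑<-𝟙≤1 n (λ i j i<j j<n → no2 i j i<j (<-trans j<n (n<1+n n))))
  ... | true  = +-monoˡ-≤ 1 (∑<-𝟙≤0 n (λ i i<n bi → no2 i n i<n (n<1+n n) bi eq))

  ∑<-𝟙≤2 : ∀ n → (∀ i j k → i < j → j < k → k < n → b i ≡ true → b j ≡ true → b k ≡ true → ⊥) → ∑< n (𝟙 ∘ b) ≤ 2
  ∑<-𝟙≤2 zero    no3 = z≤n
  ∑<-𝟙≤2 (suc n) no3 rewrite ∑<-suc n (𝟙 ∘ b) with b n in eq
  ... | false = +-monoˡ-≤ 0 (∑<-𝟙≤2 n (λ i j k i<j j<k k<n → no3 i j k i<j j<k (<-trans k<n (n<1+n n))))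
  ... | true  = +-monoˡ-≤ 1 (∑<-𝟙≤1 n (λ i j i<j j<n bi bj → no3 i j n i<j j<n (n<1+n n) bi bj eq))

-- Binary sequences of period n

-- A window is named by its first position: Isolated x i is about position 2 + i (whose two neighbours
-- are then unresolved), Empty x i and the indicators below are about position 1 + i.
Isolated : (ℕ → Bool) → ℕ → Set
Isolated x i = x i ≡ false × x (1 + i) ≡ false × x (2 + i) ≡ true × x (3 + i) ≡ false × x (4 + i) ≡ false

Empty : (ℕ → Bool) → ℕ → Set
Empty x i = x i ≡ false × x (1 + i) ≡ false × x (2 + i) ≡ false

-- Intended for `i < j < n`, so that the only pair across the cut is `0`, `n - 1`.
CyclicallyConsecutive : ℕ → ℕ → ℕ → Set
CyclicallyConsecutive n i j = j ≡ suc i ⊎ (i ≡ 0 × suc j ≡ n)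

-- Nonlocal resolving in terms of words: the fields exclude the two kinds of unresolved pairs, those
-- sharing a single neighbour in the set and those with none.
record Admissible (n : ℕ) (x : ℕ → Bool) : Set where
  field
    noIsolated : ∀ i → i < n → ¬ Isolated x i
    emptyClose : ∀ i j → i < j → j < n → Empty x i → Empty x j → CyclicallyConsecutive n i j

module _ (x : ℕ → Bool) where

  empty onlyLeft onlyRight : ℕ → Bool
  empty     i = not (x i) ∧ not (x (1 + i)) ∧ not (x (2 + i))
  onlyLeft  i = x i ∧ not (x (1 + i)) ∧ not (x (2 + i))
  onlyRight i = not (x i) ∧ not (x (1 + i)) ∧ x (2 + i)

  empty-sound : ∀ i → empty i ≡ true → Empty x i
  empty-sound i eq with x i | x (1 + i) | x (2 + i)
  empty-sound i refl | false | false | false = refl , refl , refl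

  -- An element of the set pays 2 for itself. Any other position pays its number of neighbours in
  -- the set, and the indicators make up what is missing from 2.
  local-bound : ∀ i → 2 ≤ (𝟙 (x (1 + i)) + 𝟙 (x (1 + i))) + (𝟙 (empty i) + 𝟙 (empty i)) + (𝟙 (x i) + 𝟙 (x (2 + i))) + (𝟙 (onlyLeft i) + 𝟙 (onlyRight i))
  local-bound i with x i | x (1 + i) | x (2 + i)
  ... | false | false | false = ≤-refl
  ... | false | false | true  = ≤-refl
  ... | true  | false | false = ≤-refl
  ... | true  | false | true  = ≤-refl
  ... | false | true  | false = ≤-refl
  ... | false | true  | true  = m≤m+n 2 _
  ... | true  | true  | false = m≤m+n 2 _
  ... | true  | true  | true  = m≤m+n 2 _

  -- Both indicators name `2 + i` as an only neighbour, of `3 + i` and of `1 + i` respectively. If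
  -- both held, the window at `i` would be isolated.
  private-bound : ∀ i → ¬ Isolated x i → 𝟙 (onlyLeft (2 + i)) + 𝟙 (onlyRight i) ≤ 𝟙 (x (2 + i))
  private-bound i ¬iso with x i | x (1 + i) | x (2 + i) | x (3 + i) | x (4 + i)
  ... | false | false | true  | false | false = ⊥-elim (¬iso (refl , refl , refl , refl , refl))
  ... | false | false | false | _     | _     = z≤n
  ... | false | true  | false | _     | _     = z≤n
  ... | true  | _     | false | _     | _     = z≤n
  ... | false | false | true  | false | true  = ≤-refl
  ... | false | false | true  | true  | _     = ≤-refl
  ... | false | true  | true  | false | false = ≤-refl
  ... | false | true  | true  | false | true  = z≤n
  ... | false | true  | true  | true  | _     = z≤n
  ... | true  | _     | true  | false | false = ≤-refl
  ... | true  | _     | true  | false | true  = z≤n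
  ... | true  | _     | true  | true  | _     = z≤n

-- Three positions i < j < k are never pairwise cyclically consecutive once n > 3.
no-three-empty : ∀ {n x} → 4 ≤ n → Admissible n x → ∀ i j k → i < j → j < k → k < n →
                 empty x i ≡ true → empty x j ≡ true → empty x k ≡ true → ⊥
no-three-empty {n} {x} 4≤n adm i j k i<j j<k k<n ei ej ek
  with emptyClose i j i<j (<-trans j<k k<n) (empty-sound x i ei) (empty-sound x j ej)
     | emptyClose j k j<k k<n (empty-sound x j ej) (empty-sound x k ek)
     | emptyClose i k (<-trans i<j j<k) k<n (empty-sound x i ei) (empty-sound x k ek)
  where open Admissible adm
... | inj₂ (_ , refl) | _              | _                 = contradiction (≤-trans j<k (s≤s⁻¹ k<n)) (<⇒≱ (n<1+n _))
... | inj₁ refl       | inj₂ (() , _)  | _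
... | inj₁ refl       | inj₁ refl      | inj₁ eq            = 1+n≢n eq
... | inj₁ refl       | inj₁ refl      | inj₂ (refl , refl) with 4≤n
... | s≤s (s≤s (s≤s ()))

-- `local-bound` summed over one period. The coefficient 5 is 2 for the elements themselves, 2 for
-- their incidences and 1 from `private-bound`; the constant 4 counts at most two empty positions
-- twice.
weight-bound : ∀ n x → 4 ≤ n → Periodic n x → Admissible n x → n * 2 ≤ 5 * ∑< n (𝟙 ∘ x) + 4
weight-bound n x 4≤n per adm = begin
  n * 2
    ≡⟨ ∑<-const n 2 ⟨
  ∑< n (λ _ → 2)
    ≤⟨ ∑<-mono n (λ i _ → local-bound x i) ⟩
  ∑< n (λ i → (X (1 + i) + X (1 + i)) + (E i + E i) + (X i + X (2 + i)) + (L i + R i))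
    ≡⟨ split ⟩
  (∑< n (X ∘ suc) + ∑< n (X ∘ suc)) + (∑< n E + ∑< n E) + (∑< n X + ∑< n (X ∘ (2 +_))) + (∑< n L + ∑< n R)
    ≡⟨ cong₂ (λ k k′ → (k + k) + (∑< n E + ∑< n E) + (∑< n X + k′) + (∑< n L + ∑< n R)) (∑<-shift n perX) (∑<-shift² n perX) ⟩
  (∑< n X + ∑< n X) + (∑< n E + ∑< n E) + (∑< n X + ∑< n X) + (∑< n L + ∑< n R)
    ≤⟨ +-mono-≤ (+-monoˡ-≤ (∑< n X + ∑< n X) (+-monoʳ-≤ (∑< n X + ∑< n X) (+-mono-≤ E≤2 E≤2))) L+R≤X ⟩
  (∑< n X + ∑< n X) + (2 + 2) + (∑< n X + ∑< n X) + ∑< n X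
    ≡⟨ collect (∑< n X) ⟩
  5 * ∑< n X + 4
    ∎
  where
  open ≤-Reasoning
  open Admissible adm
  X E L R : ℕ → ℕ
  X = 𝟙 ∘ x
  E = 𝟙 ∘ empty x
  L = 𝟙 ∘ onlyLeft x
  R = 𝟙 ∘ onlyRight x

  perX : Periodic n X
  perX i = cong 𝟙 (per i)

  perL : Periodic n L
  perL i rewrite per i | per (1 + i) | per (2 + i) = refl

  E≤2 : ∑< n E ≤ 2
  E≤2 = ∑<-𝟙≤2 (empty x) n (no-three-empty 4≤n adm)

  L+R≤X : ∑< n L + ∑< n R ≤ ∑< n X
  L+R≤X = begin
    -- Shifting `L` by two charges both indicators to the same element.
    ∑< n L + ∑< n R                  ≡⟨ cong (_+ ∑< n R) (∑<-shift² n perL) ⟨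
    ∑< n (L ∘ (2 +_)) + ∑< n R       ≡⟨ ∑<-+ n (L ∘ (2 +_)) R ⟨
    ∑< n (λ i → L (2 + i) + R i)     ≤⟨ ∑<-mono n (λ i i<n → private-bound x i (noIsolated i i<n)) ⟩
    ∑< n (X ∘ (2 +_))                ≡⟨ ∑<-shift² n perX ⟩
    ∑< n X                           ∎

  split : ∑< n (λ i → (X (1 + i) + X (1 + i)) + (E i + E i) + (X i + X (2 + i)) + (L i + R i))
        ≡ (∑< n (X ∘ suc) + ∑< n (X ∘ suc)) + (∑< n E + ∑< n E) + (∑< n X + ∑< n (X ∘ (2 +_))) + (∑< n L + ∑< n R)
  split = trans (∑<-+ n _ (λ i → L i + R i)) (cong₂ _+_
         (trans (∑<-+ n _ (λ i → X i + X (2 + i))) (cong₂ _+_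
         (trans (∑<-+ n _ (λ i → E i + E i)) (cong₂ _+_
           (∑<-+ n (X ∘ suc) (X ∘ suc))
           (∑<-+ n E E)))
           (∑<-+ n X (X ∘ (2 +_)))))
           (∑<-+ n L R))

  collect : ∀ k → (k + k) + (2 + 2) + (k + k) + k ≡ 5 * k + 4
  collect = solve-∀

-- The floor absorbs the slack, since `5 * k + 4 < 5 * suc k`.
quotient-bound : ∀ n k → n * 2 ≤ 5 * k + 4 → (2 * n) / 5 ≤ k
quotient-bound n k le = s≤s⁻¹ (m<n*o⇒m/o<n (≤-trans (s≤s (≤-trans (≤-reflexive (double n)) le)) (≤-reflexive (next k))))
  where
  double : ∀ n → 2 * n ≡ n * 2
  double = solve-∀
  next : ∀ k → suc (5 * k + 4) ≡ suc k * 5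
  next = solve-∀

-- The rim, with positions read modulo n

CyclicSuc-functional : ∀ {n} {i j k : Fin n} → CyclicSuc i j → CyclicSuc i k → j ≡ k
CyclicSuc-functional (inj₁ p)       (inj₁ q)       = toℕ-injective (trans (sym p) q)
CyclicSuc-functional (inj₂ (_ , p)) (inj₂ (_ , q)) = toℕ-injective (trans p (sym q))
CyclicSuc-functional {j = j} (inj₁ p) (inj₂ (q , _)) = contradiction (trans (sym p) q) (<⇒≢ (toℕ<n j))
CyclicSuc-functional {k = k} (inj₂ (q , _)) (inj₁ p) = contradiction (trans (sym p) q) (<⇒≢ (toℕ<n k))

CyclicSuc-injective : ∀ {n} {i j k : Fin n} → CyclicSuc i k → CyclicSuc j k → i ≡ j
CyclicSuc-injective (inj₁ p)       (inj₁ q)       = toℕ-injective (suc-injective (trans p (sym q)))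
CyclicSuc-injective (inj₂ (p , _)) (inj₂ (q , _)) = toℕ-injective (suc-injective (trans p (sym q)))
CyclicSuc-injective (inj₁ p)       (inj₂ (_ , q)) = contradiction (trans p q) λ ()
CyclicSuc-injective (inj₂ (_ , q)) (inj₁ p)       = contradiction (trans p q) λ ()

RimAdj : ∀ {n} → Fin n → Fin n → Set
RimAdj u v = CyclicSuc u v ⊎ CyclicSuc v u

cyclicSuc? : ∀ {n} (u v : Fin n) → Dec (CyclicSuc u v)
cyclicSuc? {n} u v = (suc (toℕ u) ≟ toℕ v) ⊎-dec ((suc (toℕ u) ≟ n) ×-dec (toℕ v ≟ 0))

rimAdj? : ∀ {n} (u v : Fin n) → Dec (RimAdj u v)
rimAdj? u v = cyclicSuc? u v ⊎-dec cyclicSuc? v u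

rimAdj-sym : ∀ {n} {u v : Fin n} → RimAdj u v → RimAdj v u
rimAdj-sym = swap

module _ {n : ℕ} .{{_ : NonZero n}} where

  vert : ℕ → Fin n
  vert i = fromℕ< (m%n<n i n)

  toℕ-vert : ∀ i → toℕ (vert i) ≡ i % n
  toℕ-vert i = toℕ-fromℕ< (m%n<n i n)

  vert-cong : ∀ {i j} → i % n ≡ j % n → vert i ≡ vert j
  vert-cong {i} {j} eq = toℕ-injective (trans (toℕ-vert i) (trans eq (sym (toℕ-vert j))))

  vert-periodic : Periodic n vert
  vert-periodic i = vert-cong ([m+n]%n≡m%n i n)

  vert-toℕ : ∀ u → vert (toℕ u) ≡ u
  vert-toℕ u = toℕ-injective (trans (toℕ-vert (toℕ u)) (m<n⇒m%n≡m (toℕ<n u)))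

  +-%-absorb : ∀ k i → (k + i % n) % n ≡ (k + i) % n
  +-%-absorb k i = begin
    (k + i % n) % n         ≡⟨ %-distribˡ-+ k (i % n) n ⟩
    (k % n + i % n % n) % n ≡⟨ cong (λ r → (k % n + r) % n) (m%n%n≡m%n i n) ⟩
    (k % n + i % n) % n     ≡⟨ %-distribˡ-+ k i n ⟨
    (k + i) % n             ∎
    where open ≡-Reasoning

  -- The offset `k` lets a given vertex be placed at position `k` of a window whose start is below
  -- `n`.
  vert-surjective : ∀ k → k ≤ n → ∀ u → ∃[ i ] i < n × vert (k + i) ≡ u
  vert-surjective k k≤n u = t % n , m%n<n t n , (begin
    vert (k + t % n)  ≡⟨ vert-cong (+-%-absorb k t) ⟩
    vert (k + t)      ≡⟨ cong vert k+t ⟩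
    vert (toℕ u + n)  ≡⟨ vert-periodic (toℕ u) ⟩
    vert (toℕ u)      ≡⟨ vert-toℕ u ⟩
    u                 ∎)
    where
    open ≡-Reasoning
    t : ℕ
    t = n ∸ k + toℕ u
    k+t : k + t ≡ toℕ u + n
    k+t = trans (sym (+-assoc k _ _)) (trans (cong (_+ toℕ u) (m+[n∸m]≡n k≤n)) (+-comm n _))

  vert-suc : ∀ i → CyclicSuc (vert i) (vert (suc i))
  vert-suc i rewrite toℕ-vert i | toℕ-vert (suc i) | sym (+-%-absorb 1 i) with m≤n⇒m<n∨m≡n (m%n<n i n)
  ... | inj₁ lt = inj₁ (sym (m<n⇒m%n≡m lt))
  ... | inj₂ eq = inj₂ (eq , trans (cong (_% n) eq) (n%n≡0 n))

  adj-left : ∀ i → RimAdj (vert (1 + i)) (vert i)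
  adj-left i = inj₂ (vert-suc i)

  adj-right : ∀ i → RimAdj (vert i) (vert (1 + i))
  adj-right i = inj₁ (vert-suc i)

  adj-inv : ∀ i {w} → RimAdj (vert (1 + i)) w → w ≡ vert i ⊎ w ≡ vert (2 + i)
  adj-inv i (inj₁ s) = inj₂ (CyclicSuc-functional s (vert-suc (1 + i)))
  adj-inv i (inj₂ s) = inj₁ (CyclicSuc-injective s (vert-suc i))

  -- Equal remainders make `n` divide `d` plus a multiple of `n`, hence `d` itself, which is below
  -- `n`.
  vert-injective : ∀ i d → d < n → vert (d + i) ≡ vert i → d ≡ 0
  vert-injective i zero      d<n eq = refl
  vert-injective i d@(suc _) d<n eq = contradiction (∣m+n∣m⇒∣n n∣ (n∣m*n (i / n))) (>⇒∤ d<n)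
    where
    open ≡-Reasoning
    rem : (d + i) % n ≡ i % n
    rem = trans (sym (toℕ-vert (d + i))) (trans (cong toℕ eq) (toℕ-vert i))
    reassoc : ∀ r s d → r + (s + d) ≡ d + (r + s)
    reassoc = solve-∀
    n∣ : n ∣ i / n * n + d
    n∣ = divides ((d + i) / n) (+-cancelˡ-≡ (i % n) _ _ (begin
      i % n + (i / n * n + d)             ≡⟨ reassoc (i % n) (i / n * n) d ⟩
      d + (i % n + i / n * n)             ≡⟨ cong (d +_) (m≡m%n+[m/n]*n i n) ⟨
      d + i                               ≡⟨ m≡m%n+[m/n]*n (d + i) n ⟩
      (d + i) % n + (d + i) / n * n       ≡⟨ cong (_+ (d + i) / n * n) rem ⟩
      i % n + (d + i) / n * n             ∎))

  vert-distinct : ∀ i d → suc d < n → vert (suc d + i) ≢ vert i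
  vert-distinct i d d<n eq = contradiction (vert-injective i (suc d) d<n eq) λ ()

  consecutive⇒adj : ∀ i j → CyclicallyConsecutive n i j → RimAdj (vert (1 + i)) (vert (1 + j))
  consecutive⇒adj i _ (inj₁ refl)          = adj-right (1 + i)
  consecutive⇒adj _ j (inj₂ (refl , refl)) = subst (RimAdj (vert 1)) (sym (vert-periodic 0)) (adj-left 0)

  -- With `j = suc i + d`, the neighbour `vert (1 + j)` is either `vert (2 + i)`, forcing `d = 0`,
  -- or `vert i`. In the second case `n` divides `d + 2`, which in this range leaves only the pair
  -- across the cut.
  adj⇒consecutive : ∀ i j → i < j → j < n → RimAdj (vert (1 + i)) (vert (1 + j)) → CyclicallyConsecutive n i j
  adj⇒consecutive i j i<j j<n a with m≤n⇒∃[o]m+o≡n i<j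
  ... | d , refl with adj-inv i a
  ...   | inj₂ eq = inj₁ (cong suc (trans (cong (i +_) d≡0) (+-identityʳ i)))
    where
    d≡0 : d ≡ 0
    d≡0 = vert-injective (2 + i) d (≤-trans (s≤s (≤-trans (m≤n+m d i) (n≤1+n _))) j<n)
            (trans (cong vert (+-comm d (2 + i))) eq)
  ...   | inj₁ eq with m≤n⇒m<n∨m≡n j<n
  ...     | inj₂ 1+j≡n = inj₂ (i≡0 , 1+j≡n)
    where
    -- vert (1 + j) = vert 0 here, so i itself is a multiple of n.
    i≡0 : i ≡ 0
    i≡0 = vert-injective 0 i (<-trans (s≤s (m≤m+n i d)) j<n)
            (trans (cong vert (+-identityʳ i)) (trans (sym eq) (trans (cong vert 1+j≡n) (vert-periodic 0))))
  ...     | inj₁ 1+j<n = contradiction (trans (cong vert (cong (2 +_) (+-comm d i))) eq)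
                           (vert-distinct i (suc d) (≤-trans (s≤s (s≤s (s≤s (m≤n+m d i)))) 1+j<n))

-- Resolving pairs of rim vertices

module _ {n : ℕ} (3≤n : 3 ≤ n) where

  private
    W : Graph (1 + n)
    W = wheel n 3≤n

  distance-self : ∀ u → Distance W u u 0
  distance-self u = [] , λ _ _ → z≤n

  distance-adj : ∀ {u v} → Adj W u v → Distance W u v 1
  distance-adj {u} {v} a = a ∷ [] , least
    where
    least : ∀ j → Walk W u v j → 1 ≤ j
    least _ []      = ⊥-elim (irreflexive W {u} refl a)
    least _ (_ ∷ _) = s≤s z≤n

  -- The hub `zero` gives a walk of length 2, so the distance between distinct rim vertices records
  -- only whether they are adjacent.
  distance-nonadj : ∀ {u v : Fin n} → u ≢ v → ¬ RimAdj u v → Distance W (suc u) (suc v) 2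
  distance-nonadj {u} {v} u≢v ¬a = _∷_ {v = zero} tt (tt ∷ []) , least
    where
    least : ∀ j → Walk W (suc u) (suc v) j → 2 ≤ j
    least _ []          = contradiction refl u≢v
    least _ (a ∷ [])    = contradiction a ¬a
    least _ (_ ∷ _ ∷ _) = s≤s (s≤s z≤n)

  -- `b` tells whether the hub belongs to the set, and `Y` is its trace on the rim.
  module _ {b : Bool} {Y : Subset n} where

    resolves-sym : ∀ {u v} → Resolves W (b ∷ Y) u v → Resolves W (b ∷ Y) v u
    resolves-sym (x , x∈ , j , k , dj , dk , j≢k) = x , x∈ , k , j , dk , dj , λ eq → j≢k (sym eq)

    resolves-self : ∀ {u v} → u ∈ Y → u ≢ v → ¬ RimAdj u v → Resolves W (b ∷ Y) (suc u) (suc v)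
    resolves-self {u} u∈Y u≢v ¬a = suc u , there u∈Y , 0 , 2 , distance-self (suc u) ,
      distance-nonadj (λ eq → u≢v (sym eq)) (λ a → ¬a (rimAdj-sym a)) , λ ()

    resolves-adj : ∀ {u v} w → w ∈ Y → v ∉ Y → RimAdj u w → ¬ RimAdj v w → Resolves W (b ∷ Y) (suc u) (suc v)
    resolves-adj {u} w w∈Y v∉Y a ¬a = suc w , there w∈Y , 1 , 2 , distance-adj {suc u} a ,
      distance-nonadj (λ { refl → v∉Y w∈Y }) ¬a , λ ()

    -- The hub is at distance 1 from both vertices. An element of `Y` differs from both, so its
    -- distances are 1 or 2 according to adjacency, and these agree.
    twins-unresolved : ∀ {u v} → u ∉ Y → v ∉ Y → (∀ w → w ∈ Y → RimAdj u w → RimAdj v w) →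
                       (∀ w → w ∈ Y → RimAdj v w → RimAdj u w) → ¬ Resolves W (b ∷ Y) (suc u) (suc v)
    twins-unresolved {u} {v} _ _ _ _ (zero , _ , j , k , dj , dk , j≢k) =
      j≢k (trans (IsLeast-unique dj (distance-adj {suc u} {zero} tt)) (IsLeast-unique (distance-adj {suc v} {zero} tt) dk))
    twins-unresolved {u} {v} u∉Y v∉Y u⇒v v⇒u (suc w , there w∈Y , j , k , dj , dk , j≢k) with rimAdj? u w
    ... | yes a = j≢k (trans (IsLeast-unique dj (distance-adj {suc u} a))
                             (IsLeast-unique (distance-adj {suc v} (u⇒v w w∈Y a)) dk))
    ... | no ¬a = j≢k (trans (IsLeast-unique dj (distance-nonadj (λ { refl → u∉Y w∈Y }) ¬a))
                             (IsLeast-unique (distance-nonadj (λ { refl → v∉Y w∈Y }) (λ a → ¬a (v⇒u w w∈Y a))) dk))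

    module _ (5≤n : 5 ≤ n) .{{_ : NonZero n}} where

      private
        x : ℕ → Bool
        x i = lookup Y (vert i)

        ∈⇒true : ∀ {i} → vert i ∈ Y → x i ≡ true
        ∈⇒true = []=⇒lookup

        false⇒∉ : ∀ {i} → x i ≡ false → vert i ∉ Y
        false⇒∉ eq w∈Y = contradiction (trans (sym eq) ([]=⇒lookup w∈Y)) λ ()

        true⇒∈ : ∀ {i} → x i ≡ true → vert i ∈ Y
        true⇒∈ {i} = lookup⇒[]= (vert i) Y

        -- An `Isolated` window covers five positions, which are distinct vertices because `5 ≤ n`.
        far : ∀ i d → suc d < 5 → vert i ≢ vert (suc d + i)
        far i d d<5 eq = vert-distinct i d (≤-trans d<5 5≤n) (sym eq)

      -- The outer neighbours `vert i` and `vert (4 + i)` lie outside `Y`, leaving `vert (2 + i)` as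
      -- the only neighbour in `Y` of either vertex.
      isolated-unresolved : ∀ i → Isolated x i → ¬ Resolves W (b ∷ Y) (suc (vert (1 + i))) (suc (vert (3 + i)))
      isolated-unresolved i (x0 , x1 , _ , x3 , x4) = twins-unresolved (false⇒∉ {1 + i} x1) (false⇒∉ {3 + i} x3) to from
        where
        to : ∀ w → w ∈ Y → RimAdj (vert (1 + i)) w → RimAdj (vert (3 + i)) w
        to w w∈Y a with adj-inv i a
        ... | inj₁ refl = contradiction w∈Y (false⇒∉ {i} x0)
        ... | inj₂ refl = adj-left (2 + i)
        from : ∀ w → w ∈ Y → RimAdj (vert (3 + i)) w → RimAdj (vert (1 + i)) w
        from w w∈Y a with adj-inv (2 + i) a
        ... | inj₁ refl = adj-right (1 + i)
        ... | inj₂ refl = contradiction w∈Y (false⇒∉ {4 + i} x4)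

      empty-isolates : ∀ i → Empty x i → ∀ w → w ∈ Y → ¬ RimAdj (vert (1 + i)) w
      empty-isolates i (x0 , _ , x2) w w∈Y a with adj-inv i a
      ... | inj₁ refl = false⇒∉ {i} x0 w∈Y
      ... | inj₂ refl = false⇒∉ {2 + i} x2 w∈Y

      isolates-empty : ∀ i → vert (1 + i) ∉ Y → (∀ w → w ∈ Y → ¬ RimAdj (vert (1 + i)) w) → Empty x i
      isolates-empty i ∉Y none =
          ¬-not (λ eq → none (vert i) (true⇒∈ {i} eq) (adj-left i))
        , ¬-not (λ eq → ∉Y (true⇒∈ {1 + i} eq))
        , ¬-not (λ eq → none (vert (2 + i)) (true⇒∈ {2 + i} eq) (adj-right (1 + i)))

      resolving⇒admissible : NonlocalResolving W (b ∷ Y) → Admissible n x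
      resolving⇒admissible res = record { noIsolated = noIsolated ; emptyClose = emptyClose }
        where
        noIsolated : ∀ i → i < n → ¬ Isolated x i
        noIsolated i _ iso = isolated-unresolved i iso (res _ _
          (λ eq → far (1 + i) 1 (m≤m+n 3 2) (Fin.suc-injective eq)) ¬adj)
          where
          ¬adj : ¬ RimAdj (vert (1 + i)) (vert (3 + i))
          ¬adj a with adj-inv i a
          ... | inj₁ eq = far i 2 (m≤m+n 4 1) (sym eq)
          ... | inj₂ eq = far (2 + i) 0 (m≤m+n 2 3) (sym eq)

        emptyClose : ∀ i j → i < j → j < n → Empty x i → Empty x j → CyclicallyConsecutive n i j
        emptyClose i j i<j j<n ei ej with rimAdj? (vert {n} (1 + i)) (vert (1 + j))
        ... | yes a = adj⇒consecutive i j i<j j<n a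
        -- Vertices without neighbours in `Y` are twins vacuously.
        ... | no ¬a = contradiction (res _ _ (λ eq → distinct (Fin.suc-injective eq)) ¬a)
                        (twins-unresolved (false⇒∉ {1 + i} (proj₁ (proj₂ ei))) (false⇒∉ {1 + j} (proj₁ (proj₂ ej)))
                          (λ w w∈Y a → contradiction a (empty-isolates i ei w w∈Y))
                          (λ w w∈Y a → contradiction a (empty-isolates j ej w w∈Y)))
          where
          distinct : vert (1 + i) ≢ vert (1 + j)
          distinct eq with m≤n⇒∃[o]m+o≡n i<j
          ... | d , refl = vert-distinct (1 + i) d (≤-trans (s≤s (s≤s (m≤n+m d i))) j<n)
                             (trans (cong vert (reorder i d)) (sym eq))
            where
            reorder : ∀ i d → suc d + (1 + i) ≡ 1 + (suc i + d)
            reorder = solve-∀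

      module _ (adm : Admissible n x) where
        open Admissible adm

        -- Either outer vertex, `vert i` or `vert (4 + i)`, resolves the pair if it is in `Y`; if
        -- neither is, the window is isolated.
        resolves-around : ∀ i → i < n → x (2 + i) ≡ true → vert (1 + i) ∉ Y → vert (3 + i) ∉ Y →
                          Resolves W (b ∷ Y) (suc (vert (1 + i))) (suc (vert (3 + i)))
        resolves-around i i<n x2 u∉Y v∉Y with x i in x0 | x (4 + i) in x4
        ... | true  | _     = resolves-adj (vert i) (true⇒∈ {i} x0) v∉Y (adj-left i) ¬adj
          where
          ¬adj : ¬ RimAdj (vert (3 + i)) (vert i)
          ¬adj a with adj-inv (2 + i) a
          ... | inj₁ eq = far i 1 (m≤m+n 3 2) eq
          ... | inj₂ eq = far i 3 (m≤m+n 5 0) eq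
        ... | false | true  = resolves-sym (resolves-adj (vert (4 + i)) (true⇒∈ {4 + i} x4) u∉Y (adj-right (3 + i)) ¬adj)
          where
          ¬adj : ¬ RimAdj (vert (1 + i)) (vert (4 + i))
          ¬adj a with adj-inv i a
          ... | inj₁ eq = far i 3 (m≤m+n 5 0) (sym eq)
          ... | inj₂ eq = far (2 + i) 1 (m≤m+n 3 2) (sym eq)
        ... | false | false = ⊥-elim (noIsolated i i<n
          (x0 , ¬-not (λ eq → u∉Y (true⇒∈ {1 + i} eq)) , x2 , ¬-not (λ eq → v∉Y (true⇒∈ {3 + i} eq)) , x4))

        resolves-common : ∀ {u v} → u ≢ v → u ∉ Y → v ∉ Y → ∀ w → w ∈ Y → RimAdj u w → RimAdj v w →
                          Resolves W (b ∷ Y) (suc u) (suc v)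
        resolves-common u≢v u∉Y v∉Y w w∈Y au av with vert-surjective 2 (≤-trans (m≤m+n 2 3) 5≤n) w
        ... | i , i<n , refl with adj-inv (1 + i) (rimAdj-sym au) | adj-inv (1 + i) (rimAdj-sym av)
        ... | inj₁ refl | inj₁ refl = contradiction refl u≢v
        ... | inj₂ refl | inj₂ refl = contradiction refl u≢v
        ... | inj₁ refl | inj₂ refl = resolves-around i i<n (∈⇒true {2 + i} w∈Y) u∉Y v∉Y
        ... | inj₂ refl | inj₁ refl = resolves-sym (resolves-around i i<n (∈⇒true {2 + i} w∈Y) v∉Y u∉Y)

        not-both-isolated : ∀ {u v} → u ≢ v → ¬ RimAdj u v → u ∉ Y → v ∉ Y → (∀ w → w ∈ Y → ¬ RimAdj u w) →
                            (∀ w → w ∈ Y → ¬ RimAdj v w) → ⊥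
        not-both-isolated {u} {v} u≢v ¬a u∉Y v∉Y noneᵘ noneᵛ
          with vert-surjective 1 (≤-trans (m≤m+n 1 4) 5≤n) u | vert-surjective 1 (≤-trans (m≤m+n 1 4) 5≤n) v
        ... | i , i<n , refl | j , j<n , refl with <-cmp i j
        ... | tri≈ _ refl _ = u≢v refl
        ... | tri< i<j _ _  = ¬a (consecutive⇒adj i j
                (emptyClose i j i<j j<n (isolates-empty i u∉Y noneᵘ) (isolates-empty j v∉Y noneᵛ)))
        ... | tri> _ _ j<i  = ¬a (rimAdj-sym (consecutive⇒adj j i
                (emptyClose j i j<i i<n (isolates-empty j v∉Y noneᵛ) (isolates-empty i u∉Y noneᵘ))))

        -- A member of `Y` resolves itself from the other vertex. Outside `Y`, an element adjacent
        -- to exactly one of the two suffices; a common neighbour is left to `noIsolated`, and the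
        -- absence of all neighbours to `emptyClose`.
        resolves-rim : ∀ u v → u ≢ v → ¬ RimAdj u v → Resolves W (b ∷ Y) (suc u) (suc v)
        resolves-rim u v u≢v ¬a with u ∈? Y | v ∈? Y
        ... | yes u∈Y | _       = resolves-self u∈Y u≢v ¬a
        ... | no _    | yes v∈Y = resolves-sym (resolves-self v∈Y (λ eq → u≢v (sym eq)) (λ a → ¬a (rimAdj-sym a)))
        ... | no u∉Y  | no v∉Y with any? (λ w → (w ∈? Y) ×-dec rimAdj? u w) | any? (λ w → (w ∈? Y) ×-dec rimAdj? v w)
        ...   | no noneᵘ | no noneᵛ = ⊥-elim (not-both-isolated u≢v ¬a u∉Y v∉Y
                  (λ w w∈Y a → noneᵘ (w , w∈Y , a)) (λ w w∈Y a → noneᵛ (w , w∈Y , a)))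
        ...   | no noneᵘ | yes (w , w∈Y , av) =
                  resolves-sym (resolves-adj w w∈Y u∉Y av (λ au → noneᵘ (w , w∈Y , au)))
        ...   | yes (w , w∈Y , au) | _ with rimAdj? v w
        ...     | yes av = resolves-common u≢v u∉Y v∉Y w w∈Y au av
        ...     | no ¬av = resolves-adj w w∈Y v∉Y au ¬av

        admissible⇒resolving : NonlocalResolving W (b ∷ Y)
        admissible⇒resolving zero    zero    u≢v _  = contradiction refl u≢v
        admissible⇒resolving zero    (suc _) _   ¬a = contradiction tt ¬a
        admissible⇒resolving (suc _) zero    _   ¬a = contradiction tt ¬a
        admissible⇒resolving (suc u) (suc v) u≢v ¬a = resolves-rim u v (λ eq → u≢v (cong suc eq)) ¬a

-- Sizes as sums, and the lower bound

∣∣≡∑< : ∀ {n} (Y : Subset n) x → (∀ u → lookup Y u ≡ x (toℕ u)) → ∣ Y ∣ ≡ ∑< n (𝟙 ∘ x)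
∣∣≡∑< []      x Y≗x = refl
∣∣≡∑< (b ∷ Y) x Y≗x with b | Y≗x zero | ∣∣≡∑< Y (x ∘ suc) (Y≗x ∘ suc)
... | true  | b≡ | eq = cong₂ _+_ (cong 𝟙 b≡) eq
... | false | b≡ | eq = cong₂ _+_ (cong 𝟙 b≡) eq

∣∣≤∣∷∣ : ∀ {n} b (Y : Subset n) → ∣ Y ∣ ≤ ∣ b ∷ Y ∣
∣∣≤∣∷∣ true  Y = n≤1+n ∣ Y ∣
∣∣≤∣∷∣ false Y = ≤-refl

-- The count concerns the trace `Y`, read as a periodic sequence; a hub in the set can only increase
-- the size.
lower-bound : ∀ n (3≤n : 3 ≤ n) → 5 ≤ n → ∀ X → NonlocalResolving (wheel n 3≤n) X → (2 * n) / 5 ≤ ∣ X ∣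
lower-bound n@(suc _) 3≤n 5≤n (b ∷ Y) res = begin
  (2 * n) / 5   ≤⟨ quotient-bound n _ (weight-bound n x (<⇒≤ 5≤n) per (resolving⇒admissible 3≤n 5≤n res)) ⟩
  ∑< n (𝟙 ∘ x)  ≡⟨ ∣∣≡∑< Y x (λ u → cong (lookup Y) (sym (vert-toℕ u))) ⟨
  ∣ Y ∣         ≤⟨ ∣∣≤∣∷∣ b Y ⟩
  ∣ b ∷ Y ∣     ∎
  where
  open ≤-Reasoning
  x : ℕ → Bool
  x i = lookup Y (vert i)
  per : Periodic n x
  per i = cong (lookup Y) (vert-periodic i)

-- An optimal set

nth : List Bool → ℕ → Bool
nth []       _       = false
nth (b ∷ _)  zero    = b
nth (_ ∷ bs) (suc i) = nth bs i

pattern ● = true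
pattern ○ = false

-- The characteristic sequence for the rim of length 7 + m, cut open: positions 7 + m, …, 10 + m
-- repeat the first four letters ●○●○.
optimal : ℕ → ℕ → Bool
optimal 0 = nth (● ∷ ○ ∷ ● ∷ ○ ∷ ○ ∷ ○ ∷ ○ ∷ ● ∷ ○ ∷ ● ∷ ○ ∷ [])
optimal 1 = nth (● ∷ ○ ∷ ● ∷ ○ ∷ ○ ∷ ○ ∷ ● ∷ ○ ∷ ● ∷ ○ ∷ ● ∷ ○ ∷ [])
optimal 2 = nth (● ∷ ○ ∷ ● ∷ ○ ∷ ○ ∷ ○ ∷ ○ ∷ ● ∷ ○ ∷ ● ∷ ○ ∷ ● ∷ ○ ∷ [])
optimal 3 = nth (● ∷ ○ ∷ ● ∷ ○ ∷ ○ ∷ ● ∷ ○ ∷ ● ∷ ○ ∷ ○ ∷ ● ∷ ○ ∷ ● ∷ ○ ∷ [])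
optimal 4 = nth (● ∷ ○ ∷ ● ∷ ○ ∷ ○ ∷ ○ ∷ ● ∷ ○ ∷ ● ∷ ○ ∷ ○ ∷ ● ∷ ○ ∷ ● ∷ ○ ∷ [])
optimal (suc (suc (suc (suc (suc m))))) = λ where
  0 → ●
  1 → ○
  2 → ●
  3 → ○
  4 → ○
  (suc (suc (suc (suc (suc i))))) → optimal m i

-- Start of the only gap that may exceed length 2.
gap : ℕ → ℕ
gap (suc (suc (suc (suc (suc m))))) = 5 + gap m
gap _                               = 3

-- This common prefix makes prepending a block safe at the seam and gives the letters repeated after
-- the cut.
optimal-prefix : ∀ m → optimal m 0 ≡ ● × optimal m 1 ≡ ○ × optimal m 2 ≡ ● × optimal m 3 ≡ ○
optimal-prefix 0 = refl , refl , refl , refl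
optimal-prefix 1 = refl , refl , refl , refl
optimal-prefix 2 = refl , refl , refl , refl
optimal-prefix 3 = refl , refl , refl , refl
optimal-prefix 4 = refl , refl , refl , refl
optimal-prefix (suc (suc (suc (suc (suc m))))) = refl , refl , refl , refl

optimal-wrap : ∀ m j → j < 4 → optimal m (7 + m + j) ≡ optimal m j
optimal-wrap m j j<4 = trans (at-end m j j<4) (sym (at-start m j j<4))
  where
  letter : ℕ → Bool
  letter = nth (● ∷ ○ ∷ ● ∷ ○ ∷ [])
  at-start : ∀ m j → j < 4 → optimal m j ≡ letter j
  at-start m 0 _ = proj₁ (optimal-prefix m)
  at-start m 1 _ = proj₁ (proj₂ (optimal-prefix m))
  at-start m 2 _ = proj₁ (proj₂ (proj₂ (optimal-prefix m)))
  at-start m 3 _ = proj₂ (proj₂ (proj₂ (optimal-prefix m)))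
  at-start m (suc (suc (suc (suc _)))) (s≤s (s≤s (s≤s (s≤s ()))))
  at-end : ∀ m j → j < 4 → optimal m (7 + m + j) ≡ letter j
  -- Each base word ends in `letter`, and both sides continue with the default `false`, so the
  -- equation computes for every `j`.
  at-end 0 j _ = refl
  at-end 1 j _ = refl
  at-end 2 j _ = refl
  at-end 3 j _ = refl
  at-end 4 j _ = refl
  at-end (suc (suc (suc (suc (suc m))))) j j<4 = at-end m j j<4

-- A gap of length at most 4 contains at most two empty windows, starting at its first two
-- positions. Confining all empty windows to one such gap makes any two of them consecutive.
WindowOK : ℕ → ℕ → Set
WindowOK m i = ¬ Isolated (optimal m) i × (Empty (optimal m) i → i ≡ gap m ⊎ i ≡ suc (gap m))

isolated? : ∀ x i → Dec (Isolated x i)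
isolated? x i = (x i ≟ᵇ ○) ×-dec (x (1 + i) ≟ᵇ ○) ×-dec (x (2 + i) ≟ᵇ ●) ×-dec (x (3 + i) ≟ᵇ ○) ×-dec (x (4 + i) ≟ᵇ ○)

empty? : ∀ x i → Dec (Empty x i)
empty? x i = (x i ≟ᵇ ○) ×-dec (x (1 + i) ≟ᵇ ○) ×-dec (x (2 + i) ≟ᵇ ○)

windowOK? : ∀ m i → Dec (WindowOK m i)
windowOK? m i = ¬? (isolated? (optimal m) i) ×-dec (empty? (optimal m) i →-dec ((i ≟ gap m) ⊎-dec (i ≟ suc (gap m))))

Fin⇒< : ∀ {n} {P : ℕ → Set} → (∀ (u : Fin n) → P (toℕ u)) → ∀ i → i < n → P i
Fin⇒< {P = P} p i i<n = subst P (toℕ-fromℕ< i<n) (p (fromℕ< i<n))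

-- The five base words are checked by decision. After a block is prepended, windows starting in it
-- are settled by its letters and the prefix of the old word; later windows are those of the old
-- word moved by 5.
optimal-windows : ∀ m i → i < 7 + m → WindowOK m i
optimal-windows 0 = Fin⇒< (toWitness {a? = all? (λ u → windowOK? 0 (toℕ u))} tt)
optimal-windows 1 = Fin⇒< (toWitness {a? = all? (λ u → windowOK? 1 (toℕ u))} tt)
optimal-windows 2 = Fin⇒< (toWitness {a? = all? (λ u → windowOK? 2 (toℕ u))} tt)
optimal-windows 3 = Fin⇒< (toWitness {a? = all? (λ u → windowOK? 3 (toℕ u))} tt)
optimal-windows 4 = Fin⇒< (toWitness {a? = all? (λ u → windowOK? 4 (toℕ u))} tt)
optimal-windows (suc (suc (suc (suc (suc m))))) i i<n with optimal-prefix m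
optimal-windows (suc (suc (suc (suc (suc m))))) 0 _ | _ = (λ { (() , _) }) , λ { (() , _) }
optimal-windows (suc (suc (suc (suc (suc m))))) 1 _ | _ = (λ { (_ , () , _) }) , λ { (_ , () , _) }
optimal-windows (suc (suc (suc (suc (suc m))))) 2 _ | _ = (λ { (() , _) }) , λ { (() , _) }
-- This window reads ○○●○●: its third letter keeps it from being empty, its fifth from being
-- isolated.
optimal-windows (suc (suc (suc (suc (suc m))))) 3 _ | p0 , _ , p2 , _ =
  (λ { (_ , _ , _ , _ , e) → contradiction (trans (sym p2) e) λ () }) ,
  (λ { (_ , _ , e) → contradiction (trans (sym p0) e) λ () })
optimal-windows (suc (suc (suc (suc (suc m))))) 4 _ | p0 , _ =
  (λ { (_ , e , _) → contradiction (trans (sym p0) e) λ () }) ,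
  (λ { (_ , e , _) → contradiction (trans (sym p0) e) λ () })
optimal-windows (suc (suc (suc (suc (suc m))))) (suc (suc (suc (suc (suc i))))) (s≤s (s≤s (s≤s (s≤s (s≤s i<n))))) | _
  with optimal-windows m i i<n
... | ¬iso , near = ¬iso , λ e → Sum.map (cong (5 +_)) (cong (5 +_)) (near e)

-- A block of five letters adds two elements, and adding 5 to the rim length raises the quotient by
-- exactly `10 / 5`.
∑<-optimal : ∀ m → ∑< (7 + m) (𝟙 ∘ optimal m) ≡ (2 * (7 + m)) / 5
∑<-optimal 0 = refl
∑<-optimal 1 = refl
∑<-optimal 2 = refl
∑<-optimal 3 = refl
∑<-optimal 4 = refl
∑<-optimal (suc (suc (suc (suc (suc m))))) = begin
  2 + ∑< (7 + m) (𝟙 ∘ optimal m) ≡⟨ cong (2 +_) (∑<-optimal m) ⟩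
  2 + (2 * (7 + m)) / 5          ≡⟨ +-distrib-/-∣ˡ (2 * (7 + m)) {5} (divides 2 refl) ⟨
  (10 + 2 * (7 + m)) / 5         ≡⟨ cong (_/ 5) (double m) ⟩
  (2 * (12 + m)) / 5             ∎
  where
  open ≡-Reasoning
  double : ∀ m → 10 + 2 * (7 + m) ≡ 2 * (12 + m)
  double = solve-∀

optimalRim : ∀ m → Subset (7 + m)
optimalRim m = tabulate (optimal m ∘ toℕ)

-- A window starting at the last position `6 + m` reaches `10 + m`, whence the bound `11 + m`. Past
-- the cut, the repeated letters match by `optimal-wrap`.
optimalRim-lookup : ∀ m i → i < 11 + m → lookup (optimalRim m) (vert i) ≡ optimal m i
optimalRim-lookup m i i<11+m = trans (lookup∘tabulate (optimal m ∘ toℕ) (vert i)) (trans (cong (optimal m) (toℕ-vert i)) reduce)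
  where
  n : ℕ
  n = 7 + m
  reduce : optimal m (i % n) ≡ optimal m i
  reduce with i <? n
  ... | yes i<n = cong (optimal m) (m<n⇒m%n≡m i<n)
  ... | no  i≮n with m≤n⇒∃[o]m+o≡n (≮⇒≥ i≮n)
  ...   | j , refl = trans (cong (optimal m) mod≡j) (sym (optimal-wrap m j j<4))
    where
    j<4 : j < 4
    j<4 = +-cancelˡ-< n j 4 (≤-trans i<11+m (≤-reflexive (+-comm 4 n)))
    mod≡j : (n + j) % n ≡ j
    mod≡j = trans (cong (_% n) (+-comm n j)) (trans ([m+n]%n≡m%n j n) (m<n⇒m%n≡m (≤-trans j<4 (m≤m+n 4 (3 + m)))))

optimalRim-admissible : ∀ m → Admissible (7 + m) (λ i → lookup (optimalRim m) (vert i))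
optimalRim-admissible m = record { noIsolated = noIsolated ; emptyClose = emptyClose }
  where
  x : ℕ → Bool
  x i = lookup (optimalRim m) (vert i)

  agree : ∀ d i → d ≤ 4 → i < 7 + m → ∀ {b} → x (d + i) ≡ b → optimal m (d + i) ≡ b
  agree d i d≤4 i<n = trans (sym (optimalRim-lookup m (d + i)
    (≤-trans (≤-reflexive (sym (+-suc d i))) (+-mono-≤ d≤4 i<n))))

  empty-agree : ∀ i → i < 7 + m → Empty x i → Empty (optimal m) i
  empty-agree i i<n (e0 , e1 , e2) = agree 0 i z≤n i<n e0 , agree 1 i (m≤m+n 1 3) i<n e1 , agree 2 i (m≤m+n 2 2) i<n e2

  noIsolated : ∀ i → i < 7 + m → ¬ Isolated x i
  noIsolated i i<n (e0 , e1 , e2 , e3 , e4) = proj₁ (optimal-windows m i i<n)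
    ( agree 0 i z≤n i<n e0 , agree 1 i (m≤m+n 1 3) i<n e1 , agree 2 i (m≤m+n 2 2) i<n e2
    , agree 3 i (m≤m+n 3 1) i<n e3 , agree 4 i ≤-refl i<n e4 )

  emptyClose : ∀ i j → i < j → j < 7 + m → Empty x i → Empty x j → CyclicallyConsecutive (7 + m) i j
  emptyClose i j i<j j<n ei ej
    with proj₂ (optimal-windows m i (<-trans i<j j<n)) (empty-agree i (<-trans i<j j<n) ei)
       | proj₂ (optimal-windows m j j<n) (empty-agree j j<n ej)
  ... | inj₁ refl | inj₁ refl = contradiction i<j (<-irrefl refl)
  ... | inj₂ refl | inj₂ refl = contradiction i<j (<-irrefl refl)
  -- The exceptional gap does not cross the cut, so the pair is consecutive in the ordinary sense.
  ... | inj₁ refl | inj₂ refl = inj₁ refl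
  ... | inj₂ refl | inj₁ refl = contradiction (n<1+n _) (<-asym i<j)

theorem4p1 : (n : ℕ) (7≤n : 7 ≤ n) → NonlocalMetricDimension (wheel n (≤-trans (m≤m+n 3 4) 7≤n)) ((2 * n) / 5)
theorem4p1 n 7≤n with m≤n⇒∃[o]m+o≡n 7≤n
... | m , refl =
    -- The hub is left out, so the size is that of the rim set.
    ( false ∷ optimalRim m
    , admissible⇒resolving 3≤n 5≤n (optimalRim-admissible m)
    , trans (∣∣≡∑< (optimalRim m) (optimal m) (lookup∘tabulate (optimal m ∘ toℕ))) (∑<-optimal m) )
  , λ { _ (X , res , refl) → lower-bound (7 + m) 3≤n 5≤n X res }
  where
  3≤n : 3 ≤ 7 + m
  3≤n = ≤-trans (m≤m+n 3 4) 7≤n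
  5≤n : 5 ≤ 7 + m
  5≤n = ≤-trans (m≤m+n 5 2) 7≤n
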